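{- Let $k$ be a positive integer and let $G$ be a $k$-connected graph on at most $5k-2$ vertices. If $P$ and $Q$ are any two longest paths in $G$, then $|V(P)\cap V(Q)|\ge k$.
   Context: All graphs are finite and simple. A graph is $k$-connected if it has more than $k$ vertices and remains connected after deleting any set of fewer than $k$ vertices. The length of a path is its number of edges, and a longest path in $G$ is a path of maximum length among all paths in $G$. $V(P)$ denotes the vertex set of $P$. -}

module Defs where

open import Data.Nat.Base using (ℕ; _≤_; _<_)
open import Data.Fin.Base using (Fin)
open import Data.Fin.Subset using (Subset; _∉_; ∣_∣; ⋃; ⁅_⁆)
open import Data.List.Base as List using (map)
open import Data.List.NonEmpty.Base as List⁺ using (List⁺; toList)
open import Data.List.Relation.Unary.Linked using (Linked)
open import Data.List.Relation.Unary.Unique.Propositional using (Unique)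
open import Data.Product.Base using (_×_)
open import Level using (0ℓ)
open import Relation.Binary.Construct.Closure.ReflexiveTransitive using (Star)
open import Relation.Binary.Core using (Rel)
open import Relation.Binary.Definitions using (Decidable; Irreflexive; Symmetric)
open import Relation.Binary.PropositionalEquality.Core using (_≡_)

-- Finite simple graphs with vertex set Fin n.
record Graph (n : ℕ) : Set₁ where
  field
    Adj    : Rel (Fin n) 0ℓ
    adj?   : Decidable Adj
    symm   : Symmetric Adj
    irrefl : Irreflexive _≡_ Adj

-- Adjacency in the graph G − S obtained by deleting the vertices in S.
AdjAfterDeleting : ∀ {n} → Graph n → Subset n → Rel (Fin n) 0ℓ
AdjAfterDeleting G S u v = u ∉ S × v ∉ S × Graph.Adj G u v

-- Any two vertices of G − S are joined by a walk in G − S. The null graph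
-- counts as connected here; in KConnected the graph G − S is never null,
-- because ∣ S ∣ < k < n.
ConnectedAfterDeleting : ∀ {n} → Graph n → Subset n → Set
ConnectedAfterDeleting G S =
  ∀ u v → u ∉ S → v ∉ S → Star (AdjAfterDeleting G S) u v

KConnected : ∀ {n} → ℕ → Graph n → Set
KConnected {n} k G =
  k < n × (∀ (S : Subset n) → ∣ S ∣ < k → ConnectedAfterDeleting G S)

-- A path is given by the sequence of its vertices, so a path and its
-- reversal are different elements of this type.
record Path {n : ℕ} (G : Graph n) : Set where
  field
    vertices : List⁺ (Fin n)
    distinct : Unique (toList vertices)
    linked   : Linked (Graph.Adj G) (toList vertices)

module _ {n : ℕ} {G : Graph n} where

  -- The number of edges: one for each vertex after the first.
  pathLength : Path G → ℕ
  pathLength P = List.length (List⁺.tail (Path.vertices P))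

  V : Path G → Subset n
  V P = ⋃ (map ⁅_⁆ (toList (Path.vertices P)))

  IsLongest : Path G → Set
  IsLongest P = ∀ (R : Path G) → pathLength R ≤ pathLength P

{-# OPTIONS --safe #-}

-- Let L be the number of vertices of P and Q, and t < k the number of common ones. As P and Q
-- together have 2L − t ≤ n vertices, 2L + 2 < 6k. Let H be a component of G − P, and call a vertex
-- of P a contact if it has a neighbour in H. Since P is longest, no two consecutive vertices are
-- contacts, the last one is not a contact, and two contacts at distance two on P have the same
-- unique neighbour in H, their owner. A set T ∌ w, with w ∈ H, that meets every edge between H
-- and P separates w from the last vertex of P, so k ≤ |T|.
--
-- Taking all contacts for T gives 2k ≤ L. If H contains two adjacent vertices u and v, replace
-- each run of contacts at successive distances two by its owner, unless the owner is u, resp. v.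
-- The resulting sets T ∌ u and T′ ∌ v satisfy 3(|T| + |T′|) ≤ 2L + 2, so 6k ≤ 2L + 2, which is
-- impossible. Hence G − P has no edges, so Q never has two consecutive vertices off P, and
-- L ≤ 2t + 1 < 2k, a contradiction. (If P spans G, then t = L = n > k.)
module Submission where

open import Defs
open import Data.Nat.Base using (ℕ; zero; suc; _+_; _≤_; _<_; _*_; _∸_; z≤n; s≤s; s≤s⁻¹)
open import Data.Nat.Properties
  using (*-monoʳ-≤; *-suc; +-cancelʳ-≤; +-cancelˡ-≤; +-comm; +-mono-≤; +-monoʳ-≤; +-monoˡ-≤; +-suc;
         <-irrefl; <-≤-trans; _≤?_; m≤m+n; m≤n⇒m≤1+n; m≤o∸n⇒m+n≤o; n<1+n; n≤0⇒n≡0; n≤1+n; ≤-<-trans;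
         ≤-antisym; ≤-refl; ≤-reflexive; ≤-trans; ≮⇒≥; module ≤-Reasoning)
open import Data.Nat.Tactic.RingSolver using (solve-∀)
open import Data.Fin.Base using (Fin; zero; suc)
open import Data.Fin.Properties using (_≟_; any?)
open import Data.Fin.Subset as Subset using (Subset; ∣_∣; _∩_; _∪_; ⋃; ⁅_⁆; inside; outside)
open import Data.Fin.Subset.Properties
  using (∉⊥; x∈⁅x⁆; x∈⁅y⁆⇒x≡y; ∣⁅x⁆∣≡1; ∣⊥∣≡0; ∣⊤∣≡n; ∈⊤; x∈p∪q⁻; x∈p∪q⁺; x∈p∩q⁺;
         x∈p∧x≢y⇒x∈p-y; x∈p⇒∣p-x∣<∣p∣)
open import Data.List.Base using (List; []; _∷_; _∷ʳ_; _++_; length; map; filter; initLast; _∷ʳ′_)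
open import Data.List.NonEmpty.Base as List⁺ using (toList)
open import Data.List.Properties using (++-assoc; length-++; length-map; length-tabulate)
open import Data.List.Membership.Propositional using (_∈_; _∉_)
open import Data.List.Membership.Propositional.Properties using (∈-++⁺ʳ; ∈-map⁺; ∈-filter⁻)
open import Data.Vec.Base using ([]; _∷_)
import Data.List.Membership.DecPropositional as DecMembership
open import Data.List.Relation.Unary.All as All using (All; []; _∷_)
import Data.List.Relation.Unary.All.Properties as All
open import Data.List.Relation.Unary.AllPairs using ([]; _∷_)
open import Data.List.Relation.Unary.Any using (here; there)
open import Data.List.Relation.Unary.Linked as Linked using (Linked; []; [-]; _∷_)
open import Data.List.Relation.Unary.Unique.Propositional using (Unique)
import Data.List.Relation.Unary.Unique.Propositional.Properties as Unique
open import Data.Product.Base using (∃; ∃-syntax; _×_; _,_; proj₁; proj₂)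
open import Data.Sum.Base as Sum using (_⊎_; inj₁; inj₂; [_,_]′)
open import Data.Empty using (⊥-elim)
open import Function.Base using (_∘_; id)
open import Relation.Binary.Construct.Closure.ReflexiveTransitive as Star using (Star; ε; _◅_; _◅◅_)
open import Relation.Binary.PropositionalEquality
  using (_≡_; _≢_; refl; sym; trans; cong; cong₂; subst; subst₂)
open import Relation.Nullary.Decidable using (Dec; yes; no; ¬?; _×-dec_; ¬¬-excluded-middle; decidable-stable)
open import Relation.Nullary.Negation using (¬_; contradiction)

-- Finite sets given by lists, and counting.

fromList : ∀ {n} → List (Fin n) → Subset n
fromList xs = ⋃ (map ⁅_⁆ xs)

∈-fromList⁺ : ∀ {n} {x : Fin n} {xs} → x ∈ xs → x Subset.∈ fromList xs
∈-fromList⁺ {x = x} (here refl) = x∈p∪q⁺ (inj₁ (x∈⁅x⁆ x))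
∈-fromList⁺ (there x∈xs)        = x∈p∪q⁺ (inj₂ (∈-fromList⁺ x∈xs))

∈-fromList⁻ : ∀ {n} {x : Fin n} xs → x Subset.∈ fromList xs → x ∈ xs
∈-fromList⁻ []       x∈⊥ = contradiction x∈⊥ ∉⊥
∈-fromList⁻ (y ∷ xs) x∈  =
  [ here ∘ x∈⁅y⁆⇒x≡y y , there ∘ ∈-fromList⁻ xs ]′ (x∈p∪q⁻ ⁅ y ⁆ (fromList xs) x∈)

∣p∪q∣≤∣p∣+∣q∣ : ∀ {n} (p q : Subset n) → ∣ p ∪ q ∣ ≤ ∣ p ∣ + ∣ q ∣
∣p∪q∣≤∣p∣+∣q∣ []            []            = z≤n
∣p∪q∣≤∣p∣+∣q∣ (inside  ∷ p) (inside  ∷ q) =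
  s≤s (≤-trans (∣p∪q∣≤∣p∣+∣q∣ p q) (+-monoʳ-≤ ∣ p ∣ (n≤1+n ∣ q ∣)))
∣p∪q∣≤∣p∣+∣q∣ (inside  ∷ p) (outside ∷ q) = s≤s (∣p∪q∣≤∣p∣+∣q∣ p q)
∣p∪q∣≤∣p∣+∣q∣ (outside ∷ p) (inside  ∷ q) =
  subst (suc ∣ p ∪ q ∣ ≤_) (sym (+-suc ∣ p ∣ ∣ q ∣)) (s≤s (∣p∪q∣≤∣p∣+∣q∣ p q))
∣p∪q∣≤∣p∣+∣q∣ (outside ∷ p) (outside ∷ q) = ∣p∪q∣≤∣p∣+∣q∣ p q

∣fromList∣≤length : ∀ {n} (xs : List (Fin n)) → ∣ fromList xs ∣ ≤ length xs
∣fromList∣≤length {n} []       = ≤-reflexive (∣⊥∣≡0 n)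
∣fromList∣≤length     (x ∷ xs) = ≤-trans (∣p∪q∣≤∣p∣+∣q∣ ⁅ x ⁆ (fromList xs))
  (+-mono-≤ (≤-reflexive (∣⁅x⁆∣≡1 x)) (∣fromList∣≤length xs))

unique⇒length≤∣p∣ : ∀ {n} {p : Subset n} {xs} →
  Unique xs → All (Subset._∈ p) xs → length xs ≤ ∣ p ∣
unique⇒length≤∣p∣         []             []           = z≤n
unique⇒length≤∣p∣ {p = p} (x∉xs ∷ xs!) (x∈p ∷ xs⊆p) = ≤-trans
  (s≤s (unique⇒length≤∣p∣ xs!
    (All.zipWith (λ (x≢y , y∈p) → x∈p∧x≢y⇒x∈p-y y∈p (x≢y ∘ sym)) (x∉xs , xs⊆p))))
  (x∈p⇒∣p-x∣<∣p∣ x∈p)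

length-filter-∁ : ∀ {A : Set} {P : A → Set} (P? : ∀ x → Dec (P x)) xs →
  length xs ≡ length (filter (¬? ∘ P?) xs) + length (filter P? xs)
length-filter-∁ P? []       = refl
length-filter-∁ P? (x ∷ xs) with P? x
... | yes _ = trans (cong suc (length-filter-∁ P? xs)) (sym (+-suc _ _))
... | no  _ = cong suc (length-filter-∁ P? xs)

-- Lets membership in a component be decided whenever the goal is stable under double negation. Each
-- instance of excluded middle is doubly negated, and finitely many of them can be nested.
¬¬-∀-dec : ∀ {n} (P : Fin n → Set) → ¬ ¬ (∀ i → Dec (P i))
¬¬-∀-dec {zero}  P ¬dec = ¬dec λ ()
¬¬-∀-dec {suc n} P ¬dec = ¬¬-excluded-middle λ P₀? →
  ¬¬-∀-dec (P ∘ suc) λ P₊? → ¬dec λ { zero → P₀? ; (suc i) → P₊? i }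

-- Surgery on vertex sequences.

module _ {A : Set} where

  unique-++⁻ : ∀ (xs : List A) {ys} → Unique (xs ++ ys) → Unique ys
  unique-++⁻ []       ys!         = ys!
  unique-++⁻ (x ∷ xs) (_ ∷ xsys!) = unique-++⁻ xs xsys!

  disjoint-++⁻ : ∀ (xs : List A) {ys x} → Unique (xs ++ ys) → x ∈ xs → x ∉ ys
  disjoint-++⁻ (_ ∷ xs) (x∉ ∷ _) (here refl) x∈ys = All.lookup x∉ (∈-++⁺ʳ xs x∈ys) refl
  disjoint-++⁻ (_ ∷ xs) (_ ∷ u)  (there x∈)  x∈ys = disjoint-++⁻ xs u x∈ x∈ys

  unique-splice : ∀ (xs ys : List A) {zs ws} → Unique (xs ++ ys ++ zs) → Unique ws →
    All (_∉ xs ++ ys ++ zs) ws → Unique (xs ++ ws ++ zs)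
  unique-splice [] ys u ws! ws∉ = Unique.++⁺ ws! (unique-++⁻ ys u)
    λ (w∈ws , w∈zs) → All.lookup ws∉ w∈ws (∈-++⁺ʳ ys w∈zs)
  unique-splice (x ∷ xs) ys {zs} {ws} (x∉ ∷ u) ws! ws∉ =
    All.++⁺ (All.++⁻ˡ xs x∉) (All.++⁺ x∉ws (All.++⁻ʳ ys (All.++⁻ʳ xs x∉))) ∷
    unique-splice xs ys u ws! (All.map (_∘ there) ws∉)
    where
    x∉ws : All (x ≢_) ws
    x∉ws = All.map (λ w∉ x≡w → w∉ (here (sym x≡w))) ws∉

  linked-++ : ∀ {R : A → A → Set} xs {y ys zs} →
    Linked R (xs ++ y ∷ ys) → Linked R (y ∷ zs) → Linked R (xs ++ y ∷ zs)
  linked-++ []           _         l′ = l′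
  linked-++ (x ∷ [])     (r ∷ l)   l′ = r ∷ l′
  linked-++ (x ∷ z ∷ xs) (r ∷ l)   l′ = r ∷ linked-++ (z ∷ xs) l l′

  linked-++⁻ : ∀ {R : A → A → Set} xs {ys} → Linked R (xs ++ ys) → Linked R ys
  linked-++⁻ []       l = l
  linked-++⁻ (x ∷ xs) l = linked-++⁻ xs (Linked.tail l)

  ≢[]⇒∷ʳ : ∀ {xs : List A} → xs ≢ [] → ∃[ ys ] ∃[ y ] ys ∷ʳ y ≡ xs
  ≢[]⇒∷ʳ {xs} xs≢[] with initLast xs
  ... | []       = contradiction refl xs≢[]
  ... | ys ∷ʳ′ y = ys , y , refl

  -- A walk indexed by its ends and its full vertex list, so that it can be spliced into another
  -- list; distinctness is imposed separately in `Bypass`.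
  data Route (R : A → A → Set) : A → A → List A → Set where
    [_] : ∀ x → Route R x x (x ∷ [])
    _∷_ : ∀ {x y z zs} → R x y → Route R y z zs → Route R x z (x ∷ zs)

  route-linked : ∀ {R : A → A → Set} {x y z xs zs} → R z x → Route R x y xs →
    Linked R (y ∷ zs) → Linked R (z ∷ xs ++ zs)
  route-linked r [ x ]     l = r ∷ l
  route-linked r (r′ ∷ rs) l = r ∷ route-linked r′ rs l

-- Rerouting a longest path through vertices off it.

module _ {n k : ℕ} (G : Graph n)
  (connected : ∀ S → ∣ S ∣ < k → ConnectedAfterDeleting G S)
  (vs : List (Fin n)) (vs! : Unique vs) (vs-linked : Linked (Graph.Adj G) vs)
  (longest : ∀ {xs} → Unique xs → Linked (Graph.Adj G) xs → length xs ≤ length vs)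
  where

  open Graph G
  open DecMembership (_≟_ {n}) using (_∈?_)

  -- Adjacency in G - V(P), so that `Star Off w` is the component of `w` for each `w ∉ vs`.
  Off : Fin n → Fin n → Set
  Off x y = x ∉ vs × y ∉ vs × Adj x y

  off-symm : ∀ {x y} → Off x y → Off y x
  off-symm (x∉ , y∉ , xy) = y∉ , x∉ , symm xy

  off-endpoint : ∀ {x y} → x ∉ vs → Star Off x y → y ∉ vs
  off-endpoint x∉ ε                     = x∉
  off-endpoint _  ((_ , y∉ , _) ◅ steps) = off-endpoint y∉ steps

  Bypass : Fin n → Fin n → List (Fin n) → Set
  Bypass x y zs = Route Adj x y zs × Unique zs × All (_∉ vs) zs

  -- Loop erasure: the part of the bypass before `x` is dropped, so that a walk returning to `x`
  -- still yields a path.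
  shorten : ∀ {x y z zs} → Bypass y z zs → x ∈ zs → ∃ (Bypass x z)
  shorten b                     (here refl) with b
  ... | [ x ]   , _ = _ , b
  ... | (_ ∷ _) , _ = _ , b
  shorten (_ ∷ r , _ ∷ u , _ ∷ o) (there x∈) = shorten (r , u , o) x∈

  bypass : ∀ {x y} → x ∉ vs → Star Off x y → ∃ (Bypass x y)
  bypass {x} x∉ ε = x ∷ [] , [ x ] , [] ∷ [] , x∉ ∷ []
  bypass {x} x∉ ((_ , y∉ , xy) ◅ steps) with bypass y∉ steps
  ... | zs , b@(r , u , o) with x ∈? zs
  ...   | yes x∈zs = shorten b x∈zs
  ...   | no  x∉zs = x ∷ zs , xy ∷ r , All.¬Any⇒All¬ zs x∉zs ∷ u , x∉ ∷ o

  -- Exchanging the segment `ms` for `zs` gives a path again, because `zs` avoids `vs`. It is no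
  -- longer than `vs`, and the common parts cancel. With `bs` empty, the path gets a new end.
  bypass-≤ : ∀ as {a} ms {bs x y zs} → as ++ a ∷ ms ++ bs ≡ vs → Adj a x →
    Bypass x y zs → Linked Adj (y ∷ bs) → length zs ≤ length ms
  bypass-≤ as {a} ms {bs} {zs = zs} refl ax (r , u , o) l =
    +-cancelʳ-≤ (length bs) _ _ (subst₂ _≤_ (length-++ zs) (length-++ ms)
      (s≤s⁻¹ (+-cancelˡ-≤ (length as) _ _ (subst₂ _≤_ (length-++ as) (length-++ as)
        (longest spliced! (linked-++ as vs-linked (route-linked ax r l)))))))
    where
    shift : ∀ cs → (as ∷ʳ a) ++ cs ≡ as ++ a ∷ cs
    shift = ++-assoc as (a ∷ [])
    spliced! : Unique (as ++ a ∷ zs ++ bs)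
    spliced! = subst Unique (shift (zs ++ bs))
      (unique-splice (as ∷ʳ a) ms (subst Unique (sym (shift (ms ++ bs))) vs!) u
        (subst (λ ws → All (_∉ ws) zs) (sym (shift (ms ++ bs))) o))

  -- A component of the graph minus the path, and its contacts.

  module Component (w : Fin n) (w∉vs : w ∉ vs) (H? : ∀ x → Dec (Star Off w x)) where

    H C : Fin n → Set
    H = Star Off w
    C a = ∃[ x ] (H x × Adj a x)

    C? : ∀ a → Dec (C a)
    C? a = any? λ x → H? x ×-dec adj? a x

    H⇒∉ : ∀ {x} → H x → x ∉ vs
    H⇒∉ = off-endpoint w∉vs

    H-bypass : ∀ {x y} → H x → H y → ∃ (Bypass x y)
    H-bypass hx hy = bypass (H⇒∉ hx) (Star.reverse off-symm hx ◅◅ hy)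

    -- Otherwise the neighbour `x` could be appended to the path.
    last-∉C : ∀ as {a} → as ++ a ∷ [] ≡ vs → ¬ C a
    last-∉C as eq (x , hx , ax)
      with () ← bypass-≤ as [] eq ax ([ x ] , [] ∷ [] , H⇒∉ hx ∷ []) [-]

    -- A bypass through `H` would insert at least one vertex between `a` and `b`.
    consecutive-∉C : ∀ as {a b bs} → as ++ a ∷ b ∷ bs ≡ vs → C a → ¬ C b
    consecutive-∉C as eq (x , hx , ax) (y , hy , by) with H-bypass hx hy
    ... | _ , bp@(r , _) = contradiction
      (bypass-≤ as [] eq ax bp (symm by ∷ suffix-linked)) (nonempty r)
      where
      nonempty : ∀ {x y zs} → Route Adj x y zs → ¬ length zs ≤ 0
      nonempty [ _ ]   ()
      nonempty (_ ∷ _) ()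
      suffix-linked : Linked Adj _
      suffix-linked = Linked.tail (linked-++⁻ as (subst (Linked Adj) (sym eq) vs-linked))

    -- A bypass that replaces `b` alone has at most one vertex, so its ends coincide.
    distance-two-owner : ∀ as {a b c cs x y} → as ++ a ∷ b ∷ c ∷ cs ≡ vs →
      H x → H y → Adj a x → Adj c y → x ≡ y
    distance-two-owner as {b = b} eq hx hy ax cy with H-bypass hx hy
    ... | _ , bp@(r , _) = singleton r
      (bypass-≤ as (b ∷ []) eq ax bp (symm cy ∷ suffix-linked))
      where
      singleton : ∀ {x y zs} → Route Adj x y zs → length zs ≤ 1 → x ≡ y
      singleton [ _ ]         _        = refl
      singleton (_ ∷ [ _ ])   (s≤s ())
      singleton (_ ∷ (_ ∷ _)) (s≤s ())
      suffix-linked : Linked Adj _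
      suffix-linked =
        Linked.tail (Linked.tail (linked-++⁻ as (subst (Linked Adj) (sym eq) vs-linked)))

    -- Sets separating the component from the end of the path.

    record Cover (u : Fin n) (T xs : List (Fin n)) : Set where
      field
        covers : ∀ {a x} → a ∈ xs → H x → Adj a x → a ∈ T ⊎ x ∈ T
        -- Keeps `u` and the last vertex of the path, which is neither a contact nor in `H`, out of
        -- `T`.
        within : All (λ y → y ≢ u × (C y ⊎ H y)) T
    open Cover

    cover-[] : ∀ {u} → Cover u [] []
    cover-[] = record { covers = λ () ; within = [] }

    cover-skip : ∀ {u T a xs} → ¬ C a → Cover u T xs → Cover u T (a ∷ xs)
    cover-skip ¬ca c = record
      { covers = λ { (here refl) hx ax → contradiction (_ , hx , ax) ¬ca
                   ; (there a∈)  hx ax → covers c a∈ hx ax }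
      ; within = within c }

    cover-add : ∀ {u T a xs} → a ≢ u → C a → Cover u T xs → Cover u (a ∷ T) (a ∷ xs)
    cover-add a≢u ca c = record
      { covers = λ { (here refl) _  _  → inj₁ (here refl)
                   ; (there a∈)  hx ax → Sum.map there there (covers c a∈ hx ax) }
      ; within = (a≢u , inj₁ ca) ∷ within c }

    replace : Fin n → Fin n → Fin n → Fin n
    replace c z y with y ≟ c
    ... | yes _ = z
    ... | no  _ = y

    replace-≢ : ∀ {c z y} → y ≢ c → replace c z y ≡ y
    replace-≢ {c} {z} {y} y≢c with y ≟ c
    ... | yes y≡c = contradiction y≡c y≢c
    ... | no  _   = refl

    replace-≡ : ∀ c z → replace c z c ≡ z
    replace-≡ c z with c ≟ c
    ... | yes _  = refl
    ... | no c≢c = contradiction refl c≢c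

    -- If z is the only neighbour in H of both a and c, then z covers a and c together.
    cover-replace : ∀ {u T a c z xs} → c ∈ xs → c ∈ vs → z ≢ u → H z → Adj c z →
      (∀ {x} → H x → Adj a x → x ≡ z) → (∀ {x} → H x → Adj c x → x ≡ z) →
      Cover u T xs → Cover u (map (replace c z) T) (a ∷ xs)
    cover-replace {u} {T} {a} {c} {z} {xs} c∈xs c∈vs z≢u hz cz a-owner c-owner cov = record
      { covers = covers′
      ; within = All.map⁺ (All.map within′ (within cov)) }
      where
      keep : ∀ {y} → y ≢ c → y ∈ T → y ∈ map (replace c z) T
      keep y≢c y∈T = subst (_∈ map (replace c z) T) (replace-≢ y≢c) (∈-map⁺ (replace c z) y∈T)
      swap : c ∈ T → z ∈ map (replace c z) T
      swap c∈T = subst (_∈ map (replace c z) T) (replace-≡ c z) (∈-map⁺ (replace c z) c∈T)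
      H≢c : ∀ {x} → H x → x ≢ c
      H≢c hx refl = H⇒∉ hx c∈vs
      -- The edge between `c` and `z` is already met: either `c` is in `T` and turns into `z`, or
      -- `z` is in `T` and survives.
      z∈T′ : z ∈ map (replace c z) T
      z∈T′ = [ swap , keep (H≢c hz) ]′ (covers cov c∈xs hz cz)
      covers′ : ∀ {b x} → b ∈ a ∷ xs → H x → Adj b x →
        b ∈ map (replace c z) T ⊎ x ∈ map (replace c z) T
      covers′ (here refl) hx ax = inj₂ (subst (_∈ map (replace c z) T) (sym (a-owner hx ax)) z∈T′)
      covers′ {b} (there b∈) hx bx with b ≟ c
      ... | yes refl = inj₂ (subst (_∈ map (replace c z) T) (sym (c-owner hx bx)) z∈T′)
      ... | no  b≢c  = Sum.map (keep b≢c) (keep (H≢c hx)) (covers cov b∈ hx bx)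
      within′ : ∀ {y} → y ≢ u × (C y ⊎ H y) → replace c z y ≢ u × (C (replace c z y) ⊎ H (replace c z y))
      within′ {y} p with y ≟ c
      ... | yes _ = z≢u , inj₂ hz
      ... | no  _ = p

    -- If `T` had fewer than `k` elements, some walk from `u` to the last vertex `e` would avoid
    -- `T`. Such a walk never leaves `H`, since it would leave along an edge that `T` meets; but `e`
    -- is on the path.
    cover-size : ∀ {u T} → H u → vs ≢ [] → Cover u T vs → k ≤ length T
    cover-size {u} {T} hu vs≢[] cov with ≢[]⇒∷ʳ vs≢[]
    ... | as , e , vs≡ = ≮⇒≥ λ T<k → H⇒∉ (reach hu
        (connected (fromList T) (<-≤-trans (s≤s (∣fromList∣≤length T)) T<k) u e
          (λ u∈ → proj₁ (All.lookup (within cov) (∈-fromList⁻ T u∈)) refl)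
          (λ e∈ → [ last-∉C as vs≡ , (λ he → H⇒∉ he e∈vs) ]′
            (proj₂ (All.lookup (within cov) (∈-fromList⁻ T e∈))))))
        e∈vs
      where
      e∈vs : e ∈ vs
      e∈vs = subst (e ∈_) vs≡ (∈-++⁺ʳ as (here refl))
      reach : ∀ {x y} → H x → Star (AdjAfterDeleting G (fromList T)) x y → H y
      reach hx ε = hx
      reach hx (_◅_ {j = y} (x∉T , y∉T , xy) steps) with y ∈? vs
      ... | yes y∈vs = ⊥-elim ([ y∉T ∘ ∈-fromList⁺ , x∉T ∘ ∈-fromList⁺ ]′
                         (covers cov y∈vs hx (symm xy)))
      ... | no  y∉vs = reach (hx ◅◅ ((H⇒∉ hx , y∉vs , xy) ◅ ε)) steps

    -- Each contact is charged two path vertices, itself and its successor, which exists and is no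
    -- contact. The prefix `as` is carried along to locate the suffix in `vs`.
    contact-cover : ∀ as xs → as ++ xs ≡ vs → ∃[ T ] (Cover w T xs × 2 * length T ≤ length xs)
    contact-cover as []       eq = [] , cover-[] , z≤n
    contact-cover as (a ∷ xs) eq with C? a
    ... | no ¬ca = let T , cov , le = contact-cover (as ∷ʳ a) xs (trans (++-assoc as _ _) eq)
                   in T , cover-skip ¬ca cov , m≤n⇒m≤1+n le
    contact-cover as (a ∷ []) eq | yes ca = contradiction ca (last-∉C as eq)
    contact-cover as (a ∷ b ∷ xs) eq | yes ca =
      let T , cov , le = contact-cover (as ++ a ∷ b ∷ []) xs (trans (++-assoc as _ _) eq)
      in a ∷ T ,
         cover-add (λ { refl → w∉vs (subst (a ∈_) eq (∈-++⁺ʳ as (here refl))) }) ca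
           (cover-skip (consecutive-∉C as eq ca) cov) ,
         subst (_≤ 2 + length xs) (sym (*-suc 2 (length T))) (s≤s (s≤s le))

    -- Two separating sets, each avoiding one of two vertices off the path.

    module _ {u v} (u≢v : u ≢ v) (u∉ : u ∉ vs) (v∉ : v ∉ vs) where

      -- Each path vertex pays for two thirds of an element of the two covers together. The summand
      -- `2` absorbs the end of the path, where a contact may have only one vertex after it.
      TwoCovers : List (Fin n) → Set
      TwoCovers xs = ∃[ T ] ∃[ T′ ] (Cover u T xs × Cover v T′ xs ×
        3 * (length T + length T′) ≤ 2 * length xs + 2)

      two-covers-skip : ∀ {a xs} → ¬ C a → TwoCovers xs → TwoCovers (a ∷ xs)
      two-covers-skip {xs = xs} ¬ca (T , T′ , cov , cov′ , le) =
        T , T′ , cover-skip ¬ca cov , cover-skip ¬ca cov′ ,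
        ≤-trans le (+-monoˡ-≤ 2 (*-monoʳ-≤ 2 (n≤1+n (length xs))))

      -- The contact `a` enters both covers, and three path vertices pay for it: both sides grow by
      -- 6.
      two-covers-far : ∀ {a b c xs} → a ∈ vs → C a → ¬ C b → ¬ C c →
        TwoCovers xs → TwoCovers (a ∷ b ∷ c ∷ xs)
      two-covers-far {xs = xs} a∈vs ca ¬cb ¬cc (T , T′ , cov , cov′ , le) =
        _ , _ , add u∉ cov , add v∉ cov′ ,
        subst₂ _≤_ (sym (lhs (length T) (length T′))) (sym (rhs (length xs))) (+-monoʳ-≤ 6 le)
        where
        add : ∀ {u T} → u ∉ vs → Cover u T xs → Cover u (_ ∷ T) (_ ∷ _ ∷ _ ∷ xs)
        add u∉ = cover-add (λ { refl → u∉ a∈vs }) ca ∘ cover-skip ¬cb ∘ cover-skip ¬cc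
        lhs : ∀ s t → 3 * (suc s + suc t) ≡ 6 + 3 * (s + t)
        lhs = solve-∀
        rhs : ∀ l → 2 * (3 + l) + 2 ≡ 6 + (2 * l + 2)
        rhs = solve-∀

      -- The common owner z joins both covers for free, except the one that must avoid z.
      two-covers-near : ∀ {a b c z xs} → a ∈ vs → c ∈ vs → C a → ¬ C b → H z → Adj c z →
        (∀ {x} → H x → Adj a x → x ≡ z) → (∀ {x} → H x → Adj c x → x ≡ z) →
        TwoCovers (c ∷ xs) → TwoCovers (a ∷ b ∷ c ∷ xs)
      two-covers-near {a} {b} {c} {z} {xs} a∈vs c∈vs ca ¬cb hz cz a-owner c-owner
        (T , T′ , cov , cov′ , le) = by-owner (z ≟ u) (z ≟ v)
        where
        ρ : List (Fin n) → List (Fin n)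
        ρ = map (replace c z)
        add : ∀ {u T} → u ∉ vs → Cover u T (c ∷ xs) → Cover u (a ∷ T) (a ∷ b ∷ c ∷ xs)
        add u∉ = cover-add (λ { refl → u∉ a∈vs }) ca ∘ cover-skip ¬cb
        merge : ∀ {u T} → z ≢ u → Cover u T (c ∷ xs) → Cover u (ρ T) (a ∷ b ∷ c ∷ xs)
        merge z≢u = cover-replace (there (here refl)) c∈vs z≢u hz cz a-owner c-owner ∘ cover-skip ¬cb
        -- The covers gain at most one element in total, which costs 3, while the vertices `a` and
        -- `b` contribute 4.
        bound : ∀ m → m ≤ suc (length T + length T′) → 3 * m ≤ 2 * (3 + length xs) + 2
        bound m m≤ = begin
          3 * m                               ≤⟨ *-monoʳ-≤ 3 m≤ ⟩
          3 * suc (length T + length T′)      ≡⟨ *-suc 3 (length T + length T′) ⟩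
          3 + 3 * (length T + length T′)      ≤⟨ +-mono-≤ (n≤1+n 3) le ⟩
          4 + (2 * suc (length xs) + 2)       ≡⟨ regroup (length xs) ⟩
          2 * (3 + length xs) + 2             ∎
          where
          open ≤-Reasoning
          regroup : ∀ l → 4 + (2 * suc l + 2) ≡ 2 * (3 + l) + 2
          regroup = solve-∀
        by-owner : Dec (z ≡ u) → Dec (z ≡ v) → TwoCovers (a ∷ b ∷ c ∷ xs)
        by-owner (yes refl) _ = a ∷ T , ρ T′ , add u∉ cov , merge u≢v cov′ ,
          bound _ (≤-reflexive (cong (suc (length T) +_) (length-map (replace c z) T′)))
        by-owner (no z≢u) (yes refl) = ρ T , a ∷ T′ , merge z≢u cov , add v∉ cov′ ,
          bound _ (≤-reflexive (trans (cong (_+ suc (length T′)) (length-map (replace c z) T)) (+-suc _ _)))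
        by-owner (no z≢u) (no z≢v) = ρ T , ρ T′ , merge z≢u cov , merge z≢v cov′ ,
          bound _ (m≤n⇒m≤1+n (≤-reflexive
            (cong₂ _+_ (length-map (replace c z) T) (length-map (replace c z) T′))))

      -- If `a` is no contact, one vertex is dropped; if `a` is one but `c` is not, three are
      -- settled at once. If both are, `c` stays in the remainder, since the run of contacts may
      -- continue from it.
      two-covers-step : ∀ as {a b c xs} → as ++ a ∷ b ∷ c ∷ xs ≡ vs → Dec (C a) → Dec (C c) →
        TwoCovers (b ∷ c ∷ xs) → TwoCovers (c ∷ xs) → TwoCovers xs → TwoCovers (a ∷ b ∷ c ∷ xs)
      two-covers-step as eq (no ¬ca) _ tc _ _ = two-covers-skip ¬ca tc
      two-covers-step as eq (yes ca) (no ¬cc) _ _ tc =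
        two-covers-far (subst (_ ∈_) eq (∈-++⁺ʳ as (here refl))) ca (consecutive-∉C as eq ca) ¬cc tc
      two-covers-step as {a} {c = c} eq (yes ca@(y , hy , ay)) (yes (z , hz , cz)) _ tc _ =
        two-covers-near (subst (a ∈_) eq (∈-++⁺ʳ as (here refl)))
          (subst (c ∈_) eq (∈-++⁺ʳ as (there (there (here refl)))))
          ca (consecutive-∉C as eq ca) hz cz a-owner c-owner tc
        where
        a-owner : ∀ {x} → H x → Adj a x → x ≡ z
        a-owner hx ax = distance-two-owner as eq hx hz ax cz
        c-owner : ∀ {x} → H x → Adj c x → x ≡ z
        c-owner hx cx = trans (sym (distance-two-owner as eq hy hx ay cx)) (a-owner hy ay)

      two-covers : ∀ as xs → as ++ xs ≡ vs → TwoCovers xs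
      two-covers as []       eq = [] , [] , cover-[] , cover-[] , z≤n
      two-covers as (a ∷ []) eq =
        two-covers-skip (last-∉C as eq) ([] , [] , cover-[] , cover-[] , z≤n)
      two-covers as (a ∷ b ∷ []) eq with C? a
      ... | no ¬ca = two-covers-skip ¬ca (two-covers (as ∷ʳ a) (b ∷ []) (trans (++-assoc as _ _) eq))
      -- The extra summand is used up here: 3 * (1 + 1) equals 2 * 2 + 2.
      ... | yes ca = a ∷ [] , a ∷ [] , cov u∉ , cov v∉ , ≤-refl
        where
        cov : ∀ {u} → u ∉ vs → Cover u (a ∷ []) (a ∷ b ∷ [])
        cov u∉ = cover-add (λ { refl → u∉ (subst (a ∈_) eq (∈-++⁺ʳ as (here refl))) }) ca
          (cover-skip (consecutive-∉C as eq ca) cover-[])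
      two-covers as (a ∷ b ∷ c ∷ xs) eq = two-covers-step as eq (C? a) (C? c)
        (two-covers (as ∷ʳ a)              (b ∷ c ∷ xs) (trans (++-assoc as _ _) eq))
        (two-covers (as ++ a ∷ b ∷ [])     (c ∷ xs)     (trans (++-assoc as _ _) eq))
        (two-covers (as ++ a ∷ b ∷ c ∷ []) xs           (trans (++-assoc as _ _) eq))

  -- Bounds on the numbers of vertices of the two paths.

  -- H is decided only under a double negation, which the decidable goal absorbs.
  2k≤length : vs ≢ [] → ∀ {w} → w ∉ vs → 2 * k ≤ length vs
  2k≤length vs≢[] {w} w∉ = decidable-stable (_ ≤? _) λ ¬le → ¬¬-∀-dec (Star Off w) λ H? →
    let open Component w w∉ H?
        T , cov , le = contact-cover [] vs refl
    in ¬le (≤-trans (*-monoʳ-≤ 2 (cover-size ε vs≢[] cov)) le)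

  -- The ends of an edge off the path share a component, so each of the two covers has at least `k`
  -- elements.
  6k≤2length+2 : vs ≢ [] → ∀ {u v} → Off u v → 6 * k ≤ 2 * length vs + 2
  6k≤2length+2 vs≢[] {u} {v} uv@(u∉ , v∉ , adj) =
    decidable-stable (_ ≤? _) λ ¬le → ¬¬-∀-dec (Star Off u) λ H? →
    let open Component u u∉ H?
        T , T′ , cov , cov′ , le = two-covers (λ u≡v → irrefl u≡v adj) u∉ v∉ [] vs refl
    in ¬le (≤-trans (≤-reflexive (regroup k)) (≤-trans
         (*-monoʳ-≤ 3 (+-mono-≤ (cover-size ε vs≢[] cov) (cover-size (uv ◅ ε) vs≢[] cov′))) le))
    where
    regroup : ∀ k → 6 * k ≡ 3 * (k + k)
    regroup = solve-∀

  -- As no edge lies off `vs`, each vertex off `vs`, except possibly a final one, is followed by one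
  -- on `vs` and can be paired with it.
  length≤1+2∣∩∣ : (∀ {u v} → ¬ Off u v) → ∀ xs → Linked Adj xs →
    length xs ≤ suc (2 * length (filter (_∈? vs) xs))
  length≤1+2∣∩∣ ¬off []       _ = z≤n
  length≤1+2∣∩∣ ¬off (x ∷ xs) l with x ∈? vs
  ... | yes _ = begin
    suc (length xs)         ≤⟨ s≤s (length≤1+2∣∩∣ ¬off xs (Linked.tail l)) ⟩
    suc (suc (2 * f))       ≤⟨ n≤1+n _ ⟩
    suc (2 + 2 * f)         ≡⟨ cong suc (sym (*-suc 2 f)) ⟩
    suc (2 * suc f)         ∎
    where
    open ≤-Reasoning
    f = length (filter (_∈? vs) xs)
  length≤1+2∣∩∣ ¬off (x ∷ [])     _        | no _  = s≤s z≤n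
  length≤1+2∣∩∣ ¬off (x ∷ y ∷ xs) (xy ∷ l) | no x∉ with y ∈? vs
  ... | no  y∉ = contradiction (x∉ , y∉ , xy) ¬off
  ... | yes _  = subst (2 + length xs ≤_) (cong suc (sym (*-suc 2 _)))
                   (s≤s (s≤s (length≤1+2∣∩∣ ¬off xs (Linked.tail l))))

  off? : ∀ u v → Dec (Off u v)
  off? u v = ¬? (u ∈? vs) ×-dec ¬? (v ∈? vs) ×-dec adj? u v

  -- Counting the common vertices of two longest paths.

  module _ (k<n : k < n) (n≤ : n ≤ 5 * k ∸ 2) (vs≢[] : vs ≢ [])
    {ws : List (Fin n)} (ws! : Unique ws) (ws-linked : Linked Adj ws)
    (|ws|≡|vs| : length ws ≡ length vs)
    where

    private
      i o : ℕ
      i = length (filter (_∈? vs) ws)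
      o = length (filter (¬? ∘ (_∈? vs)) ws)

      |vs|≡o+i : length vs ≡ o + i
      |vs|≡o+i = trans (sym |ws|≡|vs|) (length-filter-∁ (_∈? vs) ws)

      -- This is 2L - t ≤ n, where `i` is t and `o` is L - t.
      |vs|+o≤n : length vs + o ≤ n
      |vs|+o≤n = subst₂ _≤_ (length-++ vs) (∣⊤∣≡n n)
        (unique⇒length≤∣p∣ (Unique.++⁺ vs! (Unique.filter⁺ (¬? ∘ (_∈? vs)) ws!)
            λ (x∈vs , x∈f) → proj₂ (∈-filter⁻ (¬? ∘ (_∈? vs)) {xs = ws} x∈f) x∈vs)
          (All.tabulate λ _ → ∈⊤))

      -- Makes the truncated difference `5 * k ∸ 2` a true one.
      2≤5k : i < k → 2 ≤ 5 * k
      2≤5k i<k = ≤-trans (s≤s (s≤s z≤n)) (*-monoʳ-≤ 5 (≤-trans (s≤s z≤n) i<k))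

      -- One of the two copies of L is split as `o + i`; then `n + 2 ≤ 5 * k` and `suc i ≤ k` are
      -- added.
      2|vs|+2<6k : i < k → 2 * length vs + 2 < 6 * k
      2|vs|+2<6k i<k = begin
        suc (2 * length vs + 2)            ≡⟨ split (length vs) ⟩
        length vs + length vs + 3          ≡⟨ cong (λ m → length vs + m + 3) |vs|≡o+i ⟩
        length vs + (o + i) + 3            ≡⟨ regroup (length vs) o i ⟩
        (length vs + o) + 2 + suc i        ≤⟨ +-mono-≤ (+-monoˡ-≤ 2 |vs|+o≤n) i<k ⟩
        n + 2 + k                          ≤⟨ +-monoˡ-≤ k (m≤o∸n⇒m+n≤o n (2≤5k i<k) n≤) ⟩
        5 * k + k                          ≡⟨ +-comm (5 * k) k ⟩
        6 * k                              ∎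
        where
        open ≤-Reasoning
        split : ∀ l → suc (2 * l + 2) ≡ l + l + 3
        split = solve-∀
        regroup : ∀ l o i → l + (o + i) + 3 ≡ (l + o) + 2 + suc i
        regroup = solve-∀

    k≤length-filter : k ≤ length (filter (_∈? vs) ws)
    k≤length-filter = ≮⇒≥ absurd
      where
      absurd : ¬ i < k
      absurd i<k with any? (λ u → any? (off? u))
      ... | yes (u , v , off) =
        <-irrefl refl (≤-<-trans (6k≤2length+2 vs≢[] off) (2|vs|+2<6k i<k))
      ... | no ¬off with any? (λ v → ¬? (v ∈? vs))
      ... | yes (v , v∉) = <-irrefl refl (begin-strict
        suc (2 * i)   <⟨ n<1+n _ ⟩
        2 + 2 * i     ≡⟨ *-suc 2 i ⟨
        2 * suc i     ≤⟨ *-monoʳ-≤ 2 i<k ⟩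
        2 * k         ≤⟨ 2k≤length vs≢[] v∉ ⟩
        length vs     ≡⟨ |ws|≡|vs| ⟨
        length ws     ≤⟨ length≤1+2∣∩∣ (λ off → ¬off (_ , _ , off)) ws ws-linked ⟩
        suc (2 * i)   ∎)
        where open ≤-Reasoning
      ... | no ¬v∉ = <-irrefl refl (begin-strict
        n             ≤⟨ n≤|vs| ⟩
        length vs     ≡⟨ |vs|≡o+i ⟩
        o + i         ≡⟨ cong (_+ i) o≡0 ⟩
        i             <⟨ i<k ⟩
        k             <⟨ k<n ⟩
        n             ∎)
        where
        open ≤-Reasoning
        n≤|vs| : n ≤ length vs
        n≤|vs| = ≤-trans (subst (_≤ ∣ fromList vs ∣) (length-tabulate {n = n} id)
          (unique⇒length≤∣p∣ (Unique.allFin⁺ n) (All.tabulate λ {v} _ →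
            ∈-fromList⁺ (decidable-stable (v ∈? vs) λ v∉ → ¬v∉ (v , v∉)))))
          (∣fromList∣≤length vs)
        o≡0 : o ≡ 0
        o≡0 = n≤0⇒n≡0 (+-cancelˡ-≤ (length vs) o 0
          (≤-trans |vs|+o≤n (≤-trans n≤|vs| (m≤m+n (length vs) 0))))

-- Passage from vertex lists back to paths and subsets.

corollary1p5 : ∀ (k n : ℕ) → 1 ≤ k →
    (G : Graph n) → KConnected k G → n ≤ 5 * k ∸ 2 →
    (P Q : Path G) → IsLongest P → IsLongest Q →
    k ≤ ∣ V P ∩ V Q ∣
corollary1p5 k n _ G (k<n , connected) n≤ P Q P-longest Q-longest = ≤-trans
  (k≤length-filter G connected (toList P.vertices) P.distinct P.linked longest
    -- Two longest paths have equally many edges; `cong suc` turns this into equally many vertices.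
    k<n n≤ (λ ()) Q.distinct Q.linked (cong suc (≤-antisym (P-longest Q) (Q-longest P))))
  (unique⇒length≤∣p∣ (Unique.filter⁺ ∈P? Q.distinct) (All.tabulate λ x∈ →
    let x∈Q , x∈P = ∈-filter⁻ ∈P? {xs = toList Q.vertices} x∈
    in x∈p∩q⁺ (∈-fromList⁺ x∈P , ∈-fromList⁺ x∈Q)))
  where
  module P = Path P
  module Q = Path Q
  open DecMembership (_≟_ {n}) using (_∈?_)
  ∈P? : ∀ x → Dec (x ∈ toList P.vertices)
  ∈P? x = x ∈? toList P.vertices
  longest : ∀ {xs} → Unique xs → Linked (Graph.Adj G) xs → length xs ≤ length (toList P.vertices)
  longest {[]}     _   _ = z≤n
  longest {x ∷ xs} xs! l =
    s≤s (P-longest (record { vertices = x List⁺.∷ xs ; distinct = xs! ; linked = l }))
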